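{- There is a constant $c>0$ such that for all integers $m,T\ge1$ and every deterministic online algorithm for the online Multistage Matroid Maintenance (MMM) problem on the $1$-uniform matroid on $m$ elements with all acquisition costs equal to $1$ and $T$ time steps, there is a sequence of holding costs $c_t(e)\in\{0,\infty\}$ on which the algorithm's cost is at least $c\cdot\min(m,T)$ times the optimal offline cost.
   Context: The $1$-uniform matroid on $E$, $|E|=m$, has the singletons $\{e\}$ as its bases. MMM: choose a base $B_t$ for each $t\in[T]=\{1,\dots,T\}$, with cost $\sum_t(c_t(B_t)+a(B_t\setminus B_{t-1}))$, $B_0:=\emptyset$, where $c_t(B)=\sum_{e\in B}c_t(e)$ and $a(B)=\sum_{e\in B}a(e)$. Online: the holding costs $c_t(\cdot)$ are revealed at time $t$, and then the algorithm must irrevocably choose $B_t$, without knowledge of future holding costs. The optimal offline cost is the minimum cost with all holding costs known in advance. -}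

module Defs where

open import Algebra.Bundles using (RawMonoid)
import Algebra.Definitions.RawMonoid as RawMonoidDefs
open import Data.Fin using (Fin; zero; suc; inject₁; fromℕ<)
import Data.Fin as Fin
open import Data.Fin.Subset
  using (Subset; ⊥; _∪_; _─_; _-_; ⁅_⁆; _∈_; _∉_; inside; outside)
open import Data.Fin.Subset.Properties
  using (x∈⁅y⁆⇒x≡y; x∈⁅x⁆; _∈?_; ∪-identityˡ)
open import Data.Nat using (ℕ; NonZero; >-nonZero⁻¹)
open import Data.Product using (∃-syntax; _×_; _,_)
open import Data.Rational using (ℚ; 0ℚ; 1ℚ; _+_; _≤_)
open import Data.Vec using ([]; _∷_)
open import Level using (0ℓ)
open import Relation.Binary.Construct.Add.Supremum.NonStrict _≤_
  using () renaming (_≤⁺_ to _≤∞_) public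
open import Relation.Binary.PropositionalEquality
  using (_≡_; refl; trans; cong)
open import Relation.Nullary using (does)
open import Relation.Nullary.Construct.Add.Supremum
  using (_⁺; [_]) renaming (⊤⁺ to ∞) public
open import Data.Bool using (if_then_else_)

ℚ∞ : Set
ℚ∞ = ℚ ⁺

infixl 6 _+∞_

_+∞_ : ℚ∞ → ℚ∞ → ℚ∞
[ p ] +∞ [ q ] = [ p + q ]
[ p ] +∞ ∞     = ∞
∞     +∞ _     = ∞

+∞-rawMonoid : RawMonoid 0ℓ 0ℓ
+∞-rawMonoid = record { Carrier = ℚ∞ ; _≈_ = _≡_ ; _∙_ = _+∞_ ; ε = [ 0ℚ ] }

open RawMonoidDefs +∞-rawMonoid using (sum) public

record Matroid (m : ℕ) : Set₁ where
  field
    IsBase   : Subset m → Set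
    nonempty : ∃[ B ] IsBase B
    exchange : ∀ {A B} → IsBase A → IsBase B →
               ∀ {x} → x ∈ A → x ∉ B →
               ∃[ y ] y ∈ B × y ∉ A × IsBase ((A - x) ∪ ⁅ y ⁆)

private
  p─p≡⊥ : ∀ {n} (p : Subset n) → p ─ p ≡ ⊥
  p─p≡⊥ []            = refl
  p─p≡⊥ (inside  ∷ p) = cong (outside ∷_) (p─p≡⊥ p)
  p─p≡⊥ (outside ∷ p) = cong (outside ∷_) (p─p≡⊥ p)

uniform₁ : ∀ m → .{{NonZero m}} → Matroid m
uniform₁ m = record
  { IsBase   = λ B → ∃[ e ] B ≡ ⁅ e ⁆
  ; nonempty = ⁅ e₀ ⁆ , e₀ , refl
  ; exchange = exch
  }
  where
  e₀ : Fin m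
  e₀ = fromℕ< (>-nonZero⁻¹ m)

  exch : ∀ {A B : Subset m} → (∃[ a ] A ≡ ⁅ a ⁆) → (∃[ b ] B ≡ ⁅ b ⁆) →
         ∀ {x} → x ∈ A → x ∉ B →
         ∃[ y ] y ∈ B × y ∉ A × (∃[ e ] (A - x) ∪ ⁅ y ⁆ ≡ ⁅ e ⁆)
  exch (a , refl) (b , refl) x∈A x∉B with x∈⁅y⁆⇒x≡y a x∈A
  ... | refl =
    b , x∈⁅x⁆ b , (λ b∈A → x∉B (b≡a⇒a∈⁅b⁆ (x∈⁅y⁆⇒x≡y a b∈A))) , b ,
    trans (cong (_∪ ⁅ b ⁆) (p─p≡⊥ ⁅ a ⁆)) (∪-identityˡ ⁅ b ⁆)
    where
    b≡a⇒a∈⁅b⁆ : b ≡ a → a ∈ ⁅ b ⁆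
    b≡a⇒a∈⁅b⁆ refl = x∈⁅x⁆ b

-- Rationals stand in for the reals; no sign is imposed on them.
ElementCosts : ℕ → Set
ElementCosts m = Fin m → ℚ∞

-- f(B) = Σ_{e ∈ B} f(e)
weight : ∀ {m} → ElementCosts m → Subset m → ℚ∞
weight f B = sum λ e → if does (e ∈? B) then f e else [ 0ℚ ]

-- Index t : Fin T stands for time t + 1.
HoldingCosts : ℕ → ℕ → Set
HoldingCosts m T = Fin T → ElementCosts m

Schedule : ℕ → ℕ → Set
Schedule m T = Fin T → Subset m

-- B_{t-1}, with B₀ = ∅
previous : ∀ {m T} → Schedule m T → Schedule m T
previous B zero    = ⊥
previous B (suc t) = B (inject₁ t)

totalCost : ∀ {m T} → ElementCosts m → HoldingCosts m T → Schedule m T → ℚ∞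
totalCost a c B = sum λ t → weight (c t) (B t) +∞ weight a (B t ─ previous B t)

module _ {m : ℕ} (M : Matroid m) where
  open Matroid M

  Feasible : ∀ {T} → Schedule m T → Set
  Feasible B = ∀ t → IsBase (B t)

  IsOptimalCost : ∀ {T} → ElementCosts m → HoldingCosts m T → ℚ∞ → Set
  IsOptimalCost a c v =
    (∃[ B ] Feasible B × totalCost a c B ≡ v) ×
    (∀ B → Feasible B → v ≤∞ totalCost a c B)

  -- Online-ness is `causal`: the base chosen at time t is a function of the
  -- holding costs revealed up to and including time t.
  record OnlineAlgorithm (T : ℕ) : Set where
    field
      run      : HoldingCosts m T → Schedule m T
      feasible : ∀ c → Feasible (run c)
      causal   : ∀ c c′ t →
                 (∀ s → s Fin.≤ t → ∀ e → c s e ≡ c′ s e) →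
                 run c t ≡ run c′ t

unitCosts : ∀ {m} → ElementCosts m
unitCosts _ = [ 1ℚ ]

-- The adversary forbids, at each time t ≤ m, exactly the element chosen at
-- time t − 1.  The algorithm then pays at least 1 at each of the first
-- min(m , T) steps: it either holds a forbidden element or acquires a new one.
-- At most m − 1 elements are ever forbidden, so holding one of the others
-- throughout costs 1, which is optimal; κ = 1 works.
module Submission where

open import Defs
open import Data.Bool using (if_then_else_)
open import Data.Empty using (⊥-elim)
open import Data.Fin using (Fin; zero; suc; toℕ; fromℕ<; inject₁)
open import Data.Fin.Properties
  using (any?; ¬∀⟶∃¬; pigeonhole; toℕ-injective; toℕ-fromℕ<; toℕ-inject₁; toℕ<n)
open import Data.Fin.Subset using (Subset; ⊥; ⁅_⁆; _─_; _∈_; inside; outside)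
open import Data.Fin.Subset.Properties
  using (_∈?_; ∉⊥; x∈⁅x⁆; x∈⁅y⁆⇒x≡y; p─⊥≡p; x∈p∧x∉q⇒x∈p─q)
open import Data.Integer using (+_)
import Data.Integer as ℤ
import Data.Integer.Properties as ℤ
open import Data.Nat using (ℕ; zero; suc; NonZero; _⊓_; z≤n; s≤s)
import Data.Nat as ℕ
import Data.Nat.Coprimality as Coprimality
import Data.Nat.Properties as ℕ
open import Data.Nat.GeneralisedArithmetic using (fold)
open import Data.Product using (∃-syntax; _×_; _,_; proj₁; proj₂)
open import Data.Rational using (ℚ; mkℚ; 0ℚ; 1ℚ; _/_; _+_; _*_; _<_)
import Data.Rational as ℚ
import Data.Rational.Properties as ℚ
open import Data.Sum using (_⊎_; inj₁; inj₂)
open import Data.Vec using ([]; _∷_; there)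
open import Function using (_∘_)
open import Relation.Binary.Construct.Add.Supremum.NonStrict ℚ._≤_
  using ([_]; _≤⊤⁺; ≤⁺-trans; ≤⁺-reflexive-≡)
open import Relation.Binary.PropositionalEquality
  using (_≡_; refl; sym; trans; cong; cong₂; subst)
open import Relation.Nullary using (¬_; Dec; does; yes; no)
open import Relation.Nullary.Decidable using (_×-dec_)

private variable
  m n T : ℕ

-- Order and addition of extended rationals

≤∞-trans : ∀ {x y z} → x ≤∞ y → y ≤∞ z → x ≤∞ z
≤∞-trans = ≤⁺-trans ℚ.≤-trans

≤∞-reflexive : ∀ {x y} → x ≡ y → x ≤∞ y
≤∞-reflexive = ≤⁺-reflexive-≡ ℚ.≤-reflexive

+∞-mono-≤∞ : ∀ {x y u v} → x ≤∞ y → u ≤∞ v → x +∞ u ≤∞ y +∞ v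
+∞-mono-≤∞ [ p ]    [ q ]    = [ ℚ.+-mono-≤ p q ]
+∞-mono-≤∞ [ p ]    (_ ≤⊤⁺) = _ ≤⊤⁺
+∞-mono-≤∞ (_ ≤⊤⁺) _        = _ ≤⊤⁺

+∞-identityˡ : ∀ x → [ 0ℚ ] +∞ x ≡ x
+∞-identityˡ [ p ] = cong [_] (ℚ.+-identityˡ p)
+∞-identityˡ ∞     = refl

+∞-identityʳ : ∀ x → x +∞ [ 0ℚ ] ≡ x
+∞-identityʳ [ p ] = cong [_] (ℚ.+-identityʳ p)
+∞-identityʳ ∞     = refl

0≤1 : [ 0ℚ ] ≤∞ [ 1ℚ ]
0≤1 = [ ℚ.nonNegative⁻¹ 1ℚ ]

x≤x+y : ∀ x {y} → [ 0ℚ ] ≤∞ y → x ≤∞ x +∞ y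
x≤x+y x 0≤y = ≤∞-trans (≤∞-reflexive (sym (+∞-identityʳ x)))
                       (+∞-mono-≤∞ (≤∞-reflexive refl) 0≤y)

y≤x+y : ∀ {x} y → [ 0ℚ ] ≤∞ x → y ≤∞ x +∞ y
y≤x+y y 0≤x = ≤∞-trans (≤∞-reflexive (sym (+∞-identityˡ y)))
                       (+∞-mono-≤∞ 0≤x (≤∞-reflexive refl))

-- Lower bounds for finite sums

1+n/1≡[1+n]/1 : ∀ n → 1ℚ + + n / 1 ≡ + suc n / 1
1+n/1≡[1+n]/1 n =
  -- For a variable `n`, `+ n / 1` is stuck on a gcd; in the explicit form `n/1` the addition
  -- computes.
  trans (cong (λ q → 1ℚ + q) (ℚ.↥p/↧p≡p n/1))
        (cong (λ k → (ℤ.1ℤ ℤ.+ k) / 1) (ℤ.*-identityʳ (+ n)))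
  where
  n/1 : ℚ
  n/1 = mkℚ (+ n) 0 (Coprimality.sym (Coprimality.1-coprimeTo n))

sum-zero : (f : Fin n → ℚ∞) → (∀ i → f i ≡ [ 0ℚ ]) → sum f ≡ [ 0ℚ ]
sum-zero {zero}  f f≡0 = refl
sum-zero {suc n} f f≡0 = cong₂ _+∞_ (f≡0 zero) (sum-zero (f ∘ suc) (f≡0 ∘ suc))

-- Serves both sides of the ratio: `k` is 1 when bounding every schedule, and the number of elements
-- when bounding the algorithm.
k⊓n≤sum : ∀ k (f : Fin n → ℚ∞) → (∀ i → [ 0ℚ ] ≤∞ f i) →
          (∀ i → toℕ i ℕ.< k → [ 1ℚ ] ≤∞ f i) → [ + (k ⊓ n) / 1 ] ≤∞ sum f
k⊓n≤sum {zero} k f 0≤f 1≤f rewrite ℕ.⊓-zeroʳ k = ≤∞-reflexive refl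
k⊓n≤sum {suc n} zero f 0≤f 1≤f =
  +∞-mono-≤∞ (0≤f zero) (k⊓n≤sum zero (f ∘ suc) (0≤f ∘ suc) (λ _ ()))
k⊓n≤sum {suc n} (suc k) f 0≤f 1≤f =
  subst (λ q → [ q ] ≤∞ sum f) (1+n/1≡[1+n]/1 (k ⊓ n))
    (+∞-mono-≤∞ (1≤f zero (s≤s z≤n))
      (k⊓n≤sum k (f ∘ suc) (0≤f ∘ suc) (λ i i<k → 1≤f (suc i) (s≤s i<k))))

-- Weights of subsets

p─p≡⊥ : (p : Subset n) → p ─ p ≡ ⊥
p─p≡⊥ []            = refl
p─p≡⊥ (inside  ∷ p) = cong (outside ∷_) (p─p≡⊥ p)
p─p≡⊥ (outside ∷ p) = cong (outside ∷_) (p─p≡⊥ p)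

weight-⊥ : (f : ElementCosts n) → weight f ⊥ ≡ [ 0ℚ ]
weight-⊥ {zero}  f = refl
weight-⊥ {suc n} f = trans (+∞-identityˡ _) (weight-⊥ (f ∘ suc))

weight-⁅⁆ : (f : ElementCosts n) (x : Fin n) → weight f ⁅ x ⁆ ≡ f x
weight-⁅⁆ f zero    = trans (cong (f zero +∞_) (weight-⊥ (f ∘ suc))) (+∞-identityʳ _)
weight-⁅⁆ f (suc x) = trans (+∞-identityˡ _) (weight-⁅⁆ (f ∘ suc) x)

weight-nonNeg : (f : ElementCosts n) → (∀ e → [ 0ℚ ] ≤∞ f e) →
                (p : Subset n) → [ 0ℚ ] ≤∞ weight f p
weight-nonNeg f 0≤f []            = ≤∞-reflexive refl
weight-nonNeg f 0≤f (inside  ∷ p) =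
  +∞-mono-≤∞ (0≤f zero) (weight-nonNeg (f ∘ suc) (0≤f ∘ suc) p)
weight-nonNeg f 0≤f (outside ∷ p) =
  +∞-mono-≤∞ (≤∞-reflexive refl) (weight-nonNeg (f ∘ suc) (0≤f ∘ suc) p)

x∈p⇒fx≤weight : (f : ElementCosts n) → (∀ e → [ 0ℚ ] ≤∞ f e) →
                ∀ {x} (p : Subset n) → x ∈ p → f x ≤∞ weight f p
x∈p⇒fx≤weight f 0≤f {zero} (inside ∷ p) _ =
  x≤x+y _ (weight-nonNeg (f ∘ suc) (0≤f ∘ suc) p)
x∈p⇒fx≤weight f 0≤f {suc x} (inside ∷ p) (there x∈p) =
  ≤∞-trans (x∈p⇒fx≤weight (f ∘ suc) (0≤f ∘ suc) p x∈p) (y≤x+y _ (0≤f zero))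
x∈p⇒fx≤weight f 0≤f {suc x} (outside ∷ p) (there x∈p) =
  ≤∞-trans (x∈p⇒fx≤weight (f ∘ suc) (0≤f ∘ suc) p x∈p) (y≤x+y _ (≤∞-reflexive refl))

-- Step costs and the optimum

NonNegative : HoldingCosts m T → Set
NonNegative c = ∀ t e → [ 0ℚ ] ≤∞ c t e

-- Matches the summand of `totalCost` definitionally, so bounds on `sum` apply to total costs
-- directly.
stepCost : HoldingCosts m T → Schedule m T → Fin T → ℚ∞
stepCost c B t = weight (c t) (B t) +∞ weight unitCosts (B t ─ previous B t)

acquisition-nonNeg : (B : Schedule m T) → ∀ t →
                     [ 0ℚ ] ≤∞ weight unitCosts (B t ─ previous B t)
acquisition-nonNeg B t = weight-nonNeg unitCosts (λ _ → 0≤1) (B t ─ previous B t)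

stepCost-nonNeg : (c : HoldingCosts m T) → NonNegative c →
                  ∀ B t → [ 0ℚ ] ≤∞ stepCost c B t
stepCost-nonNeg c 0≤c B t =
  +∞-mono-≤∞ (weight-nonNeg (c t) (0≤c t) (B t)) (acquisition-nonNeg B t)

-- If `x` is kept, its holding cost is infinite; if it is new, it lies in `B t ─ previous B t` and
-- its unit acquisition cost is paid.
1≤stepCost : (c : HoldingCosts m T) → NonNegative c → ∀ B t {x} → x ∈ B t →
             (x ∈ previous B t → c t x ≡ ∞) → [ 1ℚ ] ≤∞ stepCost c B t
1≤stepCost c 0≤c B t {x} x∈B kept⇒∞ with x ∈? previous B t
... | yes x∈prev = ≤∞-trans
  (subst ([ 1ℚ ] ≤∞_) (sym (kept⇒∞ x∈prev)) (_ ≤⊤⁺))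
  (≤∞-trans (x∈p⇒fx≤weight (c t) (0≤c t) (B t) x∈B) (x≤x+y _ (acquisition-nonNeg B t)))
... | no x∉prev = ≤∞-trans
  (x∈p⇒fx≤weight unitCosts (λ _ → 0≤1) (B t ─ previous B t)
    (x∈p∧x∉q⇒x∈p─q x∈B x∉prev))
  (y≤x+y _ (weight-nonNeg (c t) (0≤c t) (B t)))

module _ .{{_ : NonZero m}} where

  base-member : {B : Schedule m T} → Feasible (uniform₁ m) B → ∀ t → ∃[ x ] x ∈ B t
  base-member feas t with e , eq ← feas t = e , subst (e ∈_) (sym eq) (x∈⁅x⁆ e)

  1≤totalCost : (c : HoldingCosts m (suc T)) → NonNegative c →
                ∀ B → Feasible (uniform₁ m) B → [ 1ℚ ] ≤∞ totalCost unitCosts c B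
  1≤totalCost c 0≤c B feas = k⊓n≤sum 1 (stepCost c B) (stepCost-nonNeg c 0≤c B) first
    where
    first : ∀ t → toℕ t ℕ.< 1 → [ 1ℚ ] ≤∞ stepCost c B t
    -- The schedule starts from `⊥`, so nothing can be kept at index 0 and the hypothesis on kept
    -- elements is vacuous.
    first zero _ = 1≤stepCost c 0≤c B zero (proj₂ (base-member feas zero)) (⊥-elim ∘ ∉⊥)
    first (suc _) (s≤s ())

  -- The single acquisition happens at index 0; every later set difference is empty.
  constant-totalCost : (c : HoldingCosts m (suc T)) → ∀ {x} → (∀ t → c t x ≡ [ 0ℚ ]) →
                       totalCost unitCosts c (λ _ → ⁅ x ⁆) ≡ [ 1ℚ ]
  constant-totalCost c {x} free = cong₂ _+∞_
    (cong₂ _+∞_ (holding zero)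
      (trans (cong (weight unitCosts) (p─⊥≡p ⁅ x ⁆)) (weight-⁅⁆ unitCosts x)))
    (sum-zero (stepCost c (λ _ → ⁅ x ⁆) ∘ suc) λ t → cong₂ _+∞_ (holding (suc t))
      (trans (cong (weight unitCosts) (p─p≡⊥ ⁅ x ⁆)) (weight-⊥ {m} unitCosts)))
    where
    holding : ∀ t → weight (c t) ⁅ x ⁆ ≡ [ 0ℚ ]
    holding t = trans (weight-⁅⁆ (c t) x) (free t)

  optimalCost≡1 : (c : HoldingCosts m (suc T)) → NonNegative c →
                  ∀ {x} → (∀ t → c t x ≡ [ 0ℚ ]) →
                  IsOptimalCost (uniform₁ m) unitCosts c [ 1ℚ ]
  optimalCost≡1 c 0≤c {x} free =
    ((λ _ → ⁅ x ⁆) , (λ _ → x , refl) , constant-totalCost c free) , 1≤totalCost c 0≤c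

  -- One time step thus forbids at most one element, which makes any assignment of forbidding times
  -- to elements injective.
  previous-unique : {B : Schedule m T} → Feasible (uniform₁ m) B → ∀ t {x y} →
                    x ∈ previous B t → y ∈ previous B t → x ≡ y
  previous-unique feas zero x∈ y∈ = ⊥-elim (∉⊥ x∈)
  previous-unique feas (suc t) x∈ y∈ with e , eq ← feas (inject₁ t) =
    trans (x∈⁅y⁆⇒x≡y e (subst (_ ∈_) eq x∈)) (sym (x∈⁅y⁆⇒x≡y e (subst (_ ∈_) eq y∈)))

-- Elements that the adversary never forbids

Forbidden : Schedule m T → Fin T → Fin m → Set
-- Indices below `m` are the first `m` times. Index 0 forbids nothing, so at most `m` - 1 of them
-- forbid an element.
Forbidden {m} B t e = toℕ t ℕ.< m × e ∈ previous B t

forbidden? : (B : Schedule m T) → ∀ t e → Dec (Forbidden B t e)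
forbidden? {m} B t e = (toℕ t ℕ.<? m) ×-dec (e ∈? previous B t)

-- Nothing is forbidden at index 0, so a forbidding time for each element
-- together with 0 would give m + 1 distinct indices below m.
unforbidden : {B : Schedule (suc n) T} → Feasible (uniform₁ (suc n)) B →
              ∃[ x ] (∀ t → ¬ Forbidden B t x)
unforbidden {n} {B = B} feas =
  let x , ¬∃ = ¬∀⟶∃¬ (suc n) _ (λ x → any? (λ t → forbidden? B t x)) ¬all
  in x , λ t forb → ¬∃ (t , forb)
  where
  not-at-0 : ∀ t {x} → Forbidden B t x → ¬ toℕ t ≡ 0
  not-at-0 zero (_ , x∈⊥) _ = ∉⊥ x∈⊥

  ¬all : ¬ (∀ x → ∃[ t ] Forbidden B t x)
  ¬all when = let i , j , i<j , eq = pigeonhole (ℕ.n<1+n (suc n)) index in collide i j i<j eq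
    where
    index : Fin (suc (suc n)) → Fin (suc n)
    index zero    = zero
    -- The cutoff in `Forbidden` is what puts the chosen time among the pigeonholes.
    index (suc x) = fromℕ< (proj₁ (proj₂ (when x)))

    toℕ-index : ∀ x → toℕ (index (suc x)) ≡ toℕ (proj₁ (when x))
    toℕ-index x = toℕ-fromℕ< _

    collide : ∀ i j → toℕ i ℕ.< toℕ j → ¬ index i ≡ index j
    collide zero (suc y) _ eq =
      not-at-0 _ (proj₂ (when y)) (trans (sym (toℕ-index y)) (cong toℕ (sym eq)))
    collide (suc x) (suc y) x<y eq = ℕ.<-irrefl (cong (toℕ ∘ suc) x≡y) x<y
      where
      same-time : proj₁ (when x) ≡ proj₁ (when y)
      same-time = toℕ-injective
        (trans (sym (toℕ-index x)) (trans (cong toℕ eq) (toℕ-index y)))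

      x≡y : x ≡ y
      x≡y = previous-unique feas (proj₁ (when y))
        (subst (λ t → x ∈ previous B t) same-time (proj₂ (proj₂ (when x))))
        (proj₂ (proj₂ (when y)))

-- Adaptive play against an algorithm

cost : ∀ {P : Set} → Dec P → ℚ∞
cost P? = if does P? then ∞ else [ 0ℚ ]

cost-0∨∞ : ∀ {P : Set} (P? : Dec P) → (cost P? ≡ [ 0ℚ ]) ⊎ (cost P? ≡ ∞)
cost-0∨∞ (yes _) = inj₂ refl
cost-0∨∞ (no _)  = inj₁ refl

cost-yes : ∀ {P : Set} (P? : Dec P) → P → cost P? ≡ ∞
cost-yes (yes _) p = refl
cost-yes (no ¬p) p = ⊥-elim (¬p p)

cost-no : ∀ {P : Set} (P? : Dec P) → ¬ P → cost P? ≡ [ 0ℚ ]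
cost-no (yes p) ¬p = ⊥-elim (¬p p)
cost-no (no _)  ¬p = refl

-- Takes a whole schedule, but at index `t` reads only the preceding base.
adversary : Schedule m T → HoldingCosts m T
adversary B t e = cost (forbidden? B t e)

module _ .{{_ : NonZero m}} (alg : OnlineAlgorithm (uniform₁ m) T) where
  open OnlineAlgorithm alg

  -- Costs answer the schedule and the schedule answers the costs; iterating from zero costs breaks
  -- this circle.
  approximation : ℕ → HoldingCosts m T
  approximation = fold (λ _ _ → [ 0ℚ ]) (adversary ∘ run)

  -- The adversary at time t depends on the algorithm only before t, so by
  -- causality each iteration settles one further time step.
  approximation-stable : ∀ n t → toℕ t ℕ.< n → ∀ e →
                         approximation n t e ≡ approximation (suc n) t e
  approximation-stable (suc n) t t<1+n e =
    cong (λ p → cost ((toℕ t ℕ.<? m) ×-dec (e ∈? p))) (settled t t<1+n)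
    where
    settled : ∀ t → toℕ t ℕ.< suc n →
              previous (run (approximation n)) t ≡ previous (run (approximation (suc n))) t
    settled zero    _         = refl
    -- The previous base sits at index `t`, so causality asks only for costs at `s ≤ t < n`, where
    -- the induction hypothesis applies.
    settled (suc t) (s≤s t<n) = causal _ _ (inject₁ t) λ s s≤t →
      approximation-stable n s
        (ℕ.≤-<-trans (subst (toℕ s ℕ.≤_) (toℕ-inject₁ t) s≤t) t<n)

  -- After `T` iterations every index has settled, so these costs are the adversary's answer to the
  -- very run they provoke.
  equilibrium : ∃[ c ] (∀ t e → c t e ≡ adversary (run c) t e)
  equilibrium = approximation T , λ t → approximation-stable T t (toℕ<n t)

-- Competitive lower bound

adversary-lowerBound :
  (alg : OnlineAlgorithm (uniform₁ (suc n)) (suc T)) →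
  ∃[ c ] (∀ t e → (c t e ≡ [ 0ℚ ]) ⊎ (c t e ≡ ∞)) ×
    IsOptimalCost (uniform₁ (suc n)) unitCosts c [ 1ℚ ] ×
    ([ + (suc n ⊓ suc T) / 1 ] ≤∞ totalCost unitCosts c (OnlineAlgorithm.run alg c))
adversary-lowerBound {n} {T} alg with c , c≡adv ← equilibrium alg =
  c , zero-or-∞ ,
  optimalCost≡1 c 0≤c
    -- An element that is never forbidden is free at all times, so holding it throughout attains
    -- cost 1.
    (λ t → trans (c≡adv t (proj₁ alive)) (cost-no (forbidden? B t _) (proj₂ alive t))) ,
  -- At each index below `suc n`, an element kept from the previous base is forbidden by definition.
  k⊓n≤sum (suc n) (stepCost c B) (stepCost-nonNeg c 0≤c B) λ t t<m →
    1≤stepCost c 0≤c B t (proj₂ (base-member feas t)) λ x∈prev →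
      trans (c≡adv t _) (cost-yes (forbidden? B t _) (t<m , x∈prev))
  where
  open OnlineAlgorithm alg

  B : Schedule (suc n) (suc T)
  B = run c

  feas : Feasible (uniform₁ (suc n)) B
  feas = feasible c

  alive : ∃[ x ] (∀ t → ¬ Forbidden B t x)
  alive = unforbidden feas

  zero-or-∞ : ∀ t e → (c t e ≡ [ 0ℚ ]) ⊎ (c t e ≡ ∞)
  zero-or-∞ t e rewrite c≡adv t e = cost-0∨∞ (forbidden? B t e)

  0≤c : NonNegative c
  0≤c t e with zero-or-∞ t e
  ... | inj₁ eq = ≤∞-reflexive (sym eq)
  ... | inj₂ eq = subst ([ 0ℚ ] ≤∞_) (sym eq) (_ ≤⊤⁺)

mainTheorem9 : ∃[ κ ] (0ℚ < κ) ×
    (∀ (m T : ℕ) .{{_ : NonZero m}} .{{_ : NonZero T}}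
    (alg : OnlineAlgorithm (uniform₁ m) T) →
    ∃[ c ] (∀ t e → (c t e ≡ [ 0ℚ ]) ⊎ (c t e ≡ ∞)) ×
    (∃[ opt ] IsOptimalCost (uniform₁ m) unitCosts c [ opt ] ×
    ([ κ * (+ (m ⊓ T) / 1) * opt ] ≤∞
    totalCost unitCosts c (OnlineAlgorithm.run alg c))))
mainTheorem9 = 1ℚ , ℚ.positive⁻¹ 1ℚ , lowerBound
  where
  lowerBound : ∀ (m T : ℕ) .{{_ : NonZero m}} .{{_ : NonZero T}}
    (alg : OnlineAlgorithm (uniform₁ m) T) →
    ∃[ c ] (∀ t e → (c t e ≡ [ 0ℚ ]) ⊎ (c t e ≡ ∞)) ×
    (∃[ opt ] IsOptimalCost (uniform₁ m) unitCosts c [ opt ] ×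
    ([ 1ℚ * (+ (m ⊓ T) / 1) * opt ] ≤∞
    totalCost unitCosts c (OnlineAlgorithm.run alg c)))
  lowerBound (suc n) (suc T) alg with c , 0∨∞ , opt , bound ← adversary-lowerBound alg =
    c , 0∨∞ , 1ℚ , opt ,
    -- The constant and the optimum are both 1, so the two factors drop out.
    subst (λ q → [ q ] ≤∞ totalCost unitCosts c (OnlineAlgorithm.run alg c))
      (sym (trans (ℚ.*-identityʳ _) (ℚ.*-identityˡ _))) bound
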